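{- Let $n$ be even, let $r\le s\le 2r-1$, and let $m=s-r+1$ (the number of edges of $P^{(r)}_s$). Then $$\tau(n,P^{(r)}_s)\le \tau(n,LP^{(r)}_s)\le 2h(n,r,m)+h(n,r-1,m).$$
   Context: An ordered $r$-uniform hypergraph is an $r$-uniform hypergraph whose vertex set is linearly ordered. $K^{(r)}_n$ denotes the ordered complete $r$-uniform hypergraph on vertex set $[n]=\{1,\dots,n\}$ (natural order), whose edges are all $r$-subsets of $[n]$. A copy of an ordered hypergraph $H$ in $K^{(r)}_n$ is the image of $H$ under an order-preserving injection $f:V(H)\to[n]$ (its edges being the images $f(e)$, $e\in E(H)$). The natural (tight) path $P^{(r)}_s$ has vertices $v_1<\dots<v_s$ and its edges are all sets of $r$ consecutive vertices $\{v_j,\dots,v_{j+r-1}\}$, $1\le j\le s-r+1$. The loose path $LP^{(r)}_s$ is obtained from $P^{(r)}_s$ by keeping only its first edge $\{v_1,\dots,v_r\}$ and its last edge $\{v_{s-r+1},\dots,v_s\}$ (same vertex set and order). For an ordered $r$-uniform $H$, an $H$-transversal is a set of edges of $K^{(r)}_n$ meeting (the edge set of) every copy of $H$ in $K^{(r)}_n$, and $\tau(n,H)$ is the minimum size of an $H$-transversal. An interval partition $(X,Y,Z)$ of $[n]$ consists of consecutive (possibly empty) intervals $X<Y<Z$ with union $[n]$. A set $S\subseteq[n]$ is $m$-left-biased if there is an interval partition $(X,Y,Z)$ of $[n]$ with $|X|=|Z|$, $|X\cap S|=m$ and $|Z\cap S|=0$. $h(n,t,m)$ denotes the number of $t$-subsets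 of $[n]$ that are $m$-left-biased. -}

module Defs where

open import Level using (0ℓ)
open import Data.Bool.Base using (Bool; true; false)
import Data.Bool.Properties as Bool
open import Data.Nat.Base using (ℕ; zero; suc; _+_; _∸_; _≤_; _<_; z≤n; s≤s; s≤s⁻¹)
import Data.Nat.Properties as ℕ
open import Data.Fin.Base as Fin using (Fin; zero; suc; toℕ)
import Data.Fin.Properties as Fin
open import Data.Fin.Subset as Subset using (Subset; inside; outside; _∈_; _∉_; _⊆_; _∩_; ∣_∣)
open import Data.Fin.Subset.Properties using (_∈?_; anySubset?; ⊆-antisym; ∉⊥; ∣⊥∣≡0)
open import Data.List.Base as List using (List; []; _∷_; _++_; length; filter)
open import Data.List.Extrema.Nat using (min; min≤v⁺; argmin-sel)
import Data.List.Membership.DecPropositional as DecMembership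
import Data.List.Membership.Propositional as List
open import Data.List.Membership.Propositional.Properties using (∈-map⁺; ∈-map⁻; ∈-++⁺ˡ; ∈-++⁺ʳ; ∈-filter⁺; ∈-filter⁻; ∈-∃++; ∈-++⁻)
import Data.List.Properties as List
open import Data.List.Relation.Unary.All as All using (All; []; _∷_)
open import Data.List.Relation.Unary.Any using (here; there)
open import Data.List.Relation.Unary.AllPairs using ([]; _∷_)
open import Data.List.Relation.Unary.Unique.Propositional using (Unique)
import Data.List.Relation.Unary.Unique.DecPropositional as DecUnique
import Data.List.Relation.Unary.Unique.Propositional.Properties as Unique
open import Data.Empty using (⊥; ⊥-elim)
open import Data.Product.Base using (∃; _×_; _,_; proj₁; proj₂)
open import Data.Sum.Base using (_⊎_; inj₁; inj₂)
open import Data.Vec.Base using ([]; _∷_; tabulate; _[_]≔_; here; there)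
import Data.Vec.Functional as Functional
import Data.Vec.Properties as Vec
open import Function.Base using (_∘_)
open import Function.Bundles using (mk⇔)
open import Function.Definitions using (Injective)
open import Relation.Binary.Core using (_Preserves_⟶_)
open import Relation.Binary.Definitions using (DecidableEquality)
open import Relation.Binary.PropositionalEquality using (_≡_; _≗_; refl; sym; trans; cong; subst; subst₂)
open import Relation.Nullary using (Dec; does; yes; no; contradiction)
open import Relation.Nullary.Decidable using (_×-dec_; _⊎-dec_; _→-dec_; map′; does-⇔; dec-true)
open import Relation.Unary using (Pred; Decidable)

_≟ˢ_ : ∀ {n} → DecidableEquality (Subset n)
_≟ˢ_ = Vec.≡-dec Bool._≟_

image : ∀ {v n} → (Fin v → Fin n) → Subset v → Subset n
image f p = tabulate λ y → does (Fin.any? λ x → (x ∈? p) ×-dec (f x Fin.≟ y))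

subsets : ∀ n → List (Subset n)
subsets zero    = [] ∷ []
subsets (suc n) = List.map (inside ∷_) (subsets n) ++ List.map (outside ∷_) (subsets n)

-- The t-subsets of [n]; for t = r these are the edges of the complete
-- ordered r-uniform hypergraph on [n].
subsetsOfSize : ∀ n t → List (Subset n)
subsetsOfSize n t = filter (λ S → ∣ S ∣ ℕ.≟ t) (subsets n)

-- The linearly ordered vertex set is Fin order.
record OrderedHypergraph (r : ℕ) : Set₁ where
  field
    order   : ℕ
    Edge    : Pred (Subset order) 0ℓ
    edge?   : Decidable Edge
    uniform : ∀ {e} → Edge e → ∣ e ∣ ≡ r

-- With 0-based vertices, { j , … , j + r - 1 }.
consecutive : ∀ r s → ℕ → Subset s
consecutive r s j = tabulate λ i → does ((j ℕ.≤? toℕ i) ×-dec (toℕ i ℕ.<? j + r))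

∣consecutive∣ : ∀ r s j → j + r ≤ s → ∣ consecutive r s j ∣ ≡ r
∣consecutive∣ zero zero zero z≤n = refl
∣consecutive∣ zero (suc s) zero z≤n = ∣consecutive∣ zero s zero z≤n
∣consecutive∣ (suc r) (suc s) zero (s≤s p) = cong suc (∣consecutive∣ r s zero p)
∣consecutive∣ r (suc s) (suc j) (s≤s p) =
  trans (cong ∣_∣ (Vec.tabulate-cong shift)) (∣consecutive∣ r s j p)
  where
  shift : ∀ (i : Fin s) →
          does ((suc j ℕ.≤? suc (toℕ i)) ×-dec (suc (toℕ i) ℕ.<? suc j + r)) ≡
          does ((j ℕ.≤? toℕ i) ×-dec (toℕ i ℕ.<? j + r))
  shift i = does-⇔
    (mk⇔ (λ { (s≤s a , s≤s b) → a , b }) (λ { (a , b) → s≤s a , s≤s b }))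
    ((suc j ℕ.≤? suc (toℕ i)) ×-dec (suc (toℕ i) ℕ.<? suc j + r))
    ((j ℕ.≤? toℕ i) ×-dec (toℕ i ℕ.<? j + r))

consecutive-uniform : ∀ r s (j : Fin (suc s ∸ r)) → ∣ consecutive r s (toℕ j) ∣ ≡ r
consecutive-uniform r s j = ∣consecutive∣ r s (toℕ j) (s≤s⁻¹ bound)
  where
  r≤1+s : r ≤ suc s
  r≤1+s with ℕ.≤-total r (suc s)
  ... | inj₁ r≤1+s = r≤1+s
  ... | inj₂ 1+s≤r = contradiction
    (subst (toℕ j <_) (ℕ.m≤n⇒m∸n≡0 1+s≤r) (Fin.toℕ<n j)) λ ()
  bound : toℕ j + r < suc s
  bound = subst (toℕ j + r <_) (ℕ.m∸n+n≡m r≤1+s) (ℕ.+-monoˡ-< r (Fin.toℕ<n j))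

-- The tight path has suc s ∸ r = s - r + 1 edges, indexed by their
-- (0-based) first vertex.
tightPath : ∀ r s → OrderedHypergraph r
tightPath r s = record
  { order   = s
  ; Edge    = λ e → ∃ λ (j : Fin (suc s ∸ r)) → e ≡ consecutive r s (toℕ j)
  ; edge?   = λ e → Fin.any? λ j → e ≟ˢ consecutive r s (toℕ j)
  ; uniform = λ { (j , refl) → consecutive-uniform r s j }
  }

loosePath : ∀ r s → OrderedHypergraph r
loosePath r s = record
  { order   = s
  ; Edge    = λ e → ∃ λ (j : Fin (suc s ∸ r)) → FirstOrLast j × e ≡ consecutive r s (toℕ j)
  ; edge?   = λ e → Fin.any? λ j →
      ((toℕ j ℕ.≟ 0) ⊎-dec (suc (toℕ j) ℕ.≟ suc s ∸ r)) ×-dec (e ≟ˢ consecutive r s (toℕ j))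
  ; uniform = λ { (j , _ , refl) → consecutive-uniform r s j }
  }
  where
  FirstOrLast : Fin (suc s ∸ r) → Set
  FirstOrLast j = (toℕ j ≡ 0) ⊎ (suc (toℕ j) ≡ suc s ∸ r)

record IsOrderedEmbedding {v n} (f : Fin v → Fin n) : Set where
  field
    injective       : Injective _≡_ _≡_ f
    orderPreserving : f Preserves Fin._≤_ ⟶ Fin._≤_

-- The copies of H are indexed by the embeddings f; the edges of such a
-- copy are the sets image f e with e an edge of H.  A set of edges of
-- the complete hypergraph is a duplicate-free list of r-subsets.
record IsTransversal {r} n (H : OrderedHypergraph r) (T : List (Subset n)) : Set where
  open OrderedHypergraph H using (order; Edge)
  field
    unique  : Unique T
    uniform : All (λ e → ∣ e ∣ ≡ r) T
    meets   : ∀ (f : Fin order → Fin n) → IsOrderedEmbedding f →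
              ∃ λ e → Edge e × image f e List.∈ T

record IsMinimumTransversalSize {r} n (H : OrderedHypergraph r) (k : ℕ) : Set where
  field
    attained   : ∃ λ T → IsTransversal n H T × length T ≡ k
    lowerBound : ∀ {T} → IsTransversal n H T → k ≤ length T

allFunctions? : ∀ v {n p} {P : Pred (Fin v → Fin n) p} →
                (∀ {f g} → f ≗ g → P f → P g) → Decidable P → Dec (∀ f → P f)
allFunctions? zero    resp P? = map′ (λ p f → resp (λ ()) p) (λ ∀p → ∀p Functional.[]) (P? Functional.[])
allFunctions? (suc v) resp P? =
  map′ (λ p f → resp (λ { zero → refl ; (suc i) → refl }) (p (f zero) (f ∘ suc)))
       (λ ∀p x g → ∀p (x Functional.∷ g))
       (Fin.all? λ x → allFunctions? v
         (λ f≗g → resp λ { zero → refl ; (suc i) → f≗g i })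
         (λ g → P? (x Functional.∷ g)))

isOrderedEmbedding? : ∀ {v n} → Decidable (IsOrderedEmbedding {v} {n})
isOrderedEmbedding? f =
  map′ (λ { (inj , mono) → record { injective       = λ {i} {j} → inj i j
                                  ; orderPreserving = λ {i} {j} → mono i j } })
       (λ emb → let open IsOrderedEmbedding emb in
                (λ i j → injective {i} {j}) , (λ i j → orderPreserving {i} {j}))
       ((Fin.all? λ i → Fin.all? λ j → (f i Fin.≟ f j) →-dec (i Fin.≟ j)) ×-dec
        (Fin.all? λ i → Fin.all? λ j → (i Fin.≤? j) →-dec (f i Fin.≤? f j)))

isOrderedEmbedding-resp : ∀ {v n} {f g : Fin v → Fin n} → f ≗ g →
                          IsOrderedEmbedding f → IsOrderedEmbedding g
isOrderedEmbedding-resp f≗g emb = record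
  { injective       = λ {i} {j} gi≡gj →
      injective (trans (f≗g i) (trans gi≡gj (sym (f≗g j))))
  ; orderPreserving = λ {i} {j} i≤j →
      subst₂ Fin._≤_ (f≗g i) (f≗g j) (orderPreserving i≤j)
  }
  where open IsOrderedEmbedding emb

image-cong : ∀ {v n} {f g : Fin v → Fin n} → f ≗ g → image f ≗ image g
image-cong {f = f} {g} f≗g p = Vec.tabulate-cong λ y → does-⇔
  (mk⇔ (λ { (x , x∈p , eq) → x , x∈p , trans (sym (f≗g x)) eq })
       (λ { (x , x∈p , eq) → x , x∈p , trans (f≗g x) eq }))
  (Fin.any? λ x → (x ∈? p) ×-dec (f x Fin.≟ y))
  (Fin.any? λ x → (x ∈? p) ×-dec (g x Fin.≟ y))

isTransversal? : ∀ {r} n (H : OrderedHypergraph r) → Decidable (IsTransversal n H)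
isTransversal? {r} n H T =
  map′ (λ { (u , a , m) → record { unique = u ; uniform = a ; meets = m } })
       (λ t → let open IsTransversal t in unique , uniform , meets)
       (DecUnique.unique? _≟ˢ_ T ×-dec All.all? (λ e → ∣ e ∣ ℕ.≟ r) T ×-dec
        allFunctions? order
          (λ f≗g m emb → let (e , e∈E , fe∈T) = m (isOrderedEmbedding-resp (sym ∘ f≗g) emb) in
                         e , e∈E , subst (List._∈ T) (image-cong f≗g e) fe∈T)
          (λ f → isOrderedEmbedding? f →-dec
                 anySubset? λ e → edge? e ×-dec DecMembership._∈?_ _≟ˢ_ (image f e) T))
  where open OrderedHypergraph H using (order; edge?)

sublists : ∀ {A : Set} → List A → List (List A)
sublists []       = [] ∷ []
sublists (x ∷ xs) = List.map (x ∷_) (sublists xs) ++ sublists xs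

-- If H has no edge there may be no transversal, and then τ n H is the
-- number of edges of the complete hypergraph.  As soon as H has an edge
-- that complete edge set is itself a transversal, and τ-isMinimum holds.
τ : ∀ {r} → ℕ → OrderedHypergraph r → ℕ
τ {r} n H = min (length (subsetsOfSize n r))
  (List.map length (filter (isTransversal? n H) (sublists (subsetsOfSize n r))))

-- X < Y < Z are required pairwise since Y may be empty; together with
-- the covering condition this forces each part to be an interval.
record IsIntervalPartition {n} (X Y Z : Subset n) : Set where
  field
    X<Y    : ∀ i j → i ∈ X → j ∈ Y → i Fin.< j
    Y<Z    : ∀ i j → i ∈ Y → j ∈ Z → i Fin.< j
    X<Z    : ∀ i j → i ∈ X → j ∈ Z → i Fin.< j
    covers : ∀ i → i ∈ X ⊎ i ∈ Y ⊎ i ∈ Z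

IsLeftBiased : ∀ {n} → ℕ → Subset n → Set
IsLeftBiased {n} m S = ∃ λ X → ∃ λ Y → ∃ λ Z →
  IsIntervalPartition X Y Z × ∣ X ∣ ≡ ∣ Z ∣ × ∣ X ∩ S ∣ ≡ m × ∣ Z ∩ S ∣ ≡ 0

isIntervalPartition? : ∀ {n} (X Y Z : Subset n) → Dec (IsIntervalPartition X Y Z)
isIntervalPartition? X Y Z =
  map′ (λ { (a , b , c , d) → record { X<Y = a ; Y<Z = b ; X<Z = c ; covers = d } })
       (λ p → let open IsIntervalPartition p in X<Y , Y<Z , X<Z , covers)
       (before? X Y ×-dec before? Y Z ×-dec before? X Z ×-dec
        Fin.all? λ i → (i ∈? X) ⊎-dec (i ∈? Y) ⊎-dec (i ∈? Z))
  where
  before? : ∀ {n} (A B : Subset n) → Dec (∀ i j → i ∈ A → j ∈ B → i Fin.< j)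
  before? A B = Fin.all? λ i → Fin.all? λ j →
    (i ∈? A) →-dec ((j ∈? B) →-dec (i Fin.<? j))

isLeftBiased? : ∀ {n} m → Decidable (IsLeftBiased {n} m)
isLeftBiased? m S = anySubset? λ X → anySubset? λ Y → anySubset? λ Z →
  isIntervalPartition? X Y Z ×-dec (∣ X ∣ ℕ.≟ ∣ Z ∣) ×-dec
  (∣ X ∩ S ∣ ℕ.≟ m) ×-dec (∣ Z ∩ S ∣ ℕ.≟ 0)

h : ℕ → ℕ → ℕ → ℕ
h n t m = length (filter (isLeftBiased? m) (subsetsOfSize n t))

∈-subsets : ∀ {n} (S : Subset n) → S List.∈ subsets n
∈-subsets []          = here refl
∈-subsets (true  ∷ S) = ∈-++⁺ˡ (∈-map⁺ _ (∈-subsets S))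
∈-subsets (false ∷ S) = ∈-++⁺ʳ _ (∈-map⁺ _ (∈-subsets S))

subsets-unique : ∀ n → Unique (subsets n)
subsets-unique zero    = [] ∷ []
subsets-unique (suc n) = Unique.++⁺
  (Unique.map⁺ Vec.∷-injectiveʳ (subsets-unique n))
  (Unique.map⁺ Vec.∷-injectiveʳ (subsets-unique n))
  λ { (p , q) → disjoint (∈-map⁻ _ p) (∈-map⁻ _ q) }
  where
  disjoint : ∀ {S : Subset (suc n)} →
             (∃ λ A → A List.∈ subsets n × S ≡ inside ∷ A) →
             (∃ λ B → B List.∈ subsets n × S ≡ outside ∷ B) → ⊥
  disjoint (_ , _ , refl) (_ , _ , ())

∈-subsetsOfSize : ∀ {n t} {S : Subset n} → ∣ S ∣ ≡ t → S List.∈ subsetsOfSize n t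
∈-subsetsOfSize {t = t} eq = ∈-filter⁺ (λ S → ∣ S ∣ ℕ.≟ t) (∈-subsets _) eq

subsetsOfSize-unique : ∀ n t → Unique (subsetsOfSize n t)
subsetsOfSize-unique n t = Unique.filter⁺ (λ S → ∣ S ∣ ℕ.≟ t) (subsets-unique n)

subsetsOfSize-size : ∀ n t → All (λ S → ∣ S ∣ ≡ t) (subsetsOfSize n t)
subsetsOfSize-size n t = All.tabulate (proj₂ ∘ ∈-filter⁻ (λ S → ∣ S ∣ ℕ.≟ t) {xs = subsets n})

filter∈sublists : ∀ {A : Set} {P : Pred A 0ℓ} (P? : Decidable P) xs → filter P? xs List.∈ sublists xs
filter∈sublists P? []       = here refl
filter∈sublists P? (x ∷ xs) with does (P? x)
... | true  = ∈-++⁺ˡ (∈-map⁺ _ (filter∈sublists P? xs))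
... | false = ∈-++⁺ʳ _ (filter∈sublists P? xs)

unique-length-≤ : ∀ {A : Set} {xs ys : List A} → Unique xs →
                  (∀ {x} → x List.∈ xs → x List.∈ ys) → length xs ≤ length ys
unique-length-≤ [] _ = z≤n
unique-length-≤ {xs = x ∷ xs} (x∉xs ∷ u) xs⊆ys with ∈-∃++ (xs⊆ys (here refl))
... | as , bs , refl = subst (suc (length xs) ≤_) (sym len) (s≤s (unique-length-≤ u xs⊆as++bs))
  where
  len : length (as ++ x ∷ bs) ≡ suc (length (as ++ bs))
  len = trans (List.length-++ as)
          (trans (ℕ.+-suc (length as) (length bs)) (cong suc (sym (List.length-++ as))))
  xs⊆as++bs : ∀ {y} → y List.∈ xs → y List.∈ as ++ bs
  xs⊆as++bs y∈xs with ∈-++⁻ as (xs⊆ys (there y∈xs))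
  ... | inj₁ y∈as         = ∈-++⁺ˡ y∈as
  ... | inj₂ (here y≡x)   = contradiction (sym y≡x) (All.lookup x∉xs y∈xs)
  ... | inj₂ (there y∈bs) = ∈-++⁺ʳ as y∈bs

∈-image⁺ : ∀ {v n} {f : Fin v → Fin n} {p x} → x ∈ p → f x ∈ image f p
∈-image⁺ {f = f} {p} {x} x∈p = Vec.lookup⇒[]= (f x) (image f p)
  (trans (Vec.lookup∘tabulate _ (f x))
         (dec-true (Fin.any? λ z → (z ∈? p) ×-dec (f z Fin.≟ f x)) (x , x∈p , refl)))

∈-image⁻ : ∀ {v n} {f : Fin v → Fin n} {p y} → y ∈ image f p → ∃ λ x → x ∈ p × f x ≡ y
∈-image⁻ {f = f} {p} {y} y∈ with Fin.any? (λ z → (z ∈? p) ×-dec (f z Fin.≟ y))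
                               | trans (sym (Vec.lookup∘tabulate _ y)) (Vec.[]=⇒lookup y∈)
... | yes r | _ = r

∣insert∣ : ∀ {n} (p : Subset n) x → x ∉ p → ∣ p [ x ]≔ inside ∣ ≡ suc ∣ p ∣
∣insert∣ (true  ∷ p) zero    x∉p = contradiction here x∉p
∣insert∣ (false ∷ p) zero    x∉p = refl
∣insert∣ (true  ∷ p) (suc x) x∉p = cong suc (∣insert∣ p x (x∉p ∘ there))
∣insert∣ (false ∷ p) (suc x) x∉p = ∣insert∣ p x (x∉p ∘ there)

∣image∣ : ∀ {v n} {f : Fin v → Fin n} → Injective _≡_ _≡_ f → ∀ p → ∣ image f p ∣ ≡ ∣ p ∣
∣image∣ {n = n} {f} inj [] = trans (cong ∣_∣ (⊆-antisym ⊆⊥ (⊥-elim ∘ ∉⊥))) (∣⊥∣≡0 n)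
  where
  ⊆⊥ : image f [] ⊆ Subset.⊥
  ⊆⊥ y∈ with () ← proj₁ (∈-image⁻ {f = f} {p = []} y∈)
∣image∣ {f = f} inj (false ∷ p) =
  trans (cong ∣_∣ (⊆-antisym ⊆₁ ⊆₂)) (∣image∣ (Fin.suc-injective ∘ inj) p)
  where
  ⊆₁ : image f (outside ∷ p) ⊆ image (f ∘ suc) p
  ⊆₁ y∈ with ∈-image⁻ {f = f} {p = outside ∷ p} y∈
  ... | suc x , there x∈p , refl = ∈-image⁺ {f = f ∘ suc} x∈p
  ⊆₂ : image (f ∘ suc) p ⊆ image f (outside ∷ p)
  ⊆₂ y∈ with ∈-image⁻ {f = f ∘ suc} {p = p} y∈
  ... | x , x∈p , refl = ∈-image⁺ {f = f} {p = outside ∷ p} (there x∈p)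
∣image∣ {f = f} inj (true ∷ p) =
  trans (cong ∣_∣ (⊆-antisym ⊆₁ ⊆₂))
    (trans (∣insert∣ q (f zero) f0∉q) (cong suc (∣image∣ (Fin.suc-injective ∘ inj) p)))
  where
  q = image (f ∘ suc) p
  f0∉q : f zero ∉ q
  f0∉q f0∈q with ∈-image⁻ {f = f ∘ suc} {p = p} f0∈q
  ... | x , _ , eq with () ← inj eq
  ⊆₁ : image f (inside ∷ p) ⊆ q [ f zero ]≔ inside
  ⊆₁ y∈ with ∈-image⁻ {f = f} {p = inside ∷ p} y∈
  ... | zero  , _         , refl = Vec.[]≔-updates q (f zero)
  ... | suc x , there x∈p , refl =
    Vec.[]≔-minimal q (f (suc x)) (f zero) (λ eq → Fin.0≢1+n (sym (inj eq))) (∈-image⁺ {f = f ∘ suc} x∈p)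
  ⊆₂ : q [ f zero ]≔ inside ⊆ image f (inside ∷ p)
  ⊆₂ {y} y∈ with y Fin.≟ f zero
  ... | yes refl = ∈-image⁺ {f = f} {p = inside ∷ p} here
  ... | no y≢f0 with ∈-image⁻ {f = f ∘ suc} {p = p}
                       (Vec.lookup⇒[]= y q (trans (sym (Vec.lookup∘update′ y≢f0 q inside)) (Vec.[]=⇒lookup y∈)))
  ...   | x , x∈p , refl = ∈-image⁺ {f = f} {p = inside ∷ p} (there x∈p)

τ-isMinimum : ∀ {r} n (H : OrderedHypergraph r) → ∃ (OrderedHypergraph.Edge H) →
              IsMinimumTransversalSize n H (τ n H)
τ-isMinimum {r} n H (e , e∈E) = record { attained = attained ; lowerBound = lowerBound }
  where
  K  = subsetsOfSize n r
  Ts = filter (isTransversal? n H) (sublists K)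

  complete : IsTransversal n H K
  complete = record
    { unique  = subsetsOfSize-unique n r
    ; uniform = subsetsOfSize-size n r
    ; meets   = λ f emb → e , e∈E ,
        ∈-subsetsOfSize (trans (∣image∣ (IsOrderedEmbedding.injective emb) e)
                               (OrderedHypergraph.uniform H e∈E))
    }

  attained : ∃ λ T → IsTransversal n H T × length T ≡ τ n H
  attained with argmin-sel (λ k → k) (length K) (List.map length Ts)
  ... | inj₁ eq = K , complete , sym eq
  ... | inj₂ ∈Ts with ∈-map⁻ length ∈Ts
  ...   | T , T∈Ts , eq = T , proj₂ (∈-filter⁻ (isTransversal? n H) {xs = sublists K} T∈Ts) , sym eq

  lowerBound : ∀ {T} → IsTransversal n H T → τ n H ≤ length T
  lowerBound {T} tr = min≤v⁺ (length K) (List.map length Ts)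
    (inj₂ (List.lose (∈-map⁺ length (∈-filter⁺ (isTransversal? n H) (filter∈sublists ∈T? K) tr′)) T′≤T))
    where
    open IsTransversal tr
    ∈T? = λ e → DecMembership._∈?_ _≟ˢ_ e T
    T′ = filter ∈T? K
    T′≤T : length T′ ≤ length T
    T′≤T = unique-length-≤ (Unique.filter⁺ ∈T? (subsetsOfSize-unique n r))
             (proj₂ ∘ ∈-filter⁻ ∈T? {xs = K})
    tr′ : IsTransversal n H T′
    tr′ = record
      { unique  = Unique.filter⁺ ∈T? (subsetsOfSize-unique n r)
      ; uniform = All.tabulate λ e∈T′ →
          All.lookup uniform (proj₂ (∈-filter⁻ ∈T? {xs = K} e∈T′))
      ; meets   = λ f emb → let (e , e∈E , fe∈T) = meets f emb in
          e , e∈E , ∈-filter⁺ ∈T? (∈-subsetsOfSize (All.lookup uniform fe∈T)) fe∈T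
      }

{-# OPTIONS --safe #-}

-- Write v₀ < … < v₍ₛ₋₁₎ for the vertices of a copy of the loose path and d = s - r,
-- so that m = d + 1.  Its first edge is m-left-biased if v_d + v₍ᵣ₋₁₎ < n - 1, and
-- its last edge is the reflection of an m-left-biased set if v_d + v₍ᵣ₋₁₎ > n - 1.
-- In the case of equality, d < r - 1 because n is even; deleting v₍ᵣ₋₁₎ from the
-- first edge leaves an m-left-biased (r-1)-set, whose m-th element v_d determines
-- the deleted vertex as its reflection.
module Submission where

open import Defs
open import Data.Nat using (ℕ; suc; _+_; _*_; _∸_; _≤_; _<_; z≤n; s≤s; s≤s⁻¹; _≤?_; _<?_; _≟_)
open import Data.Nat.Properties using (≤-refl; ≤-trans; ≤-reflexive; <⇒≤; <⇒≱; ≰⇒>; <-≤-trans; ≤-<-trans; <-cmp; m≤m+n; m≤n+m; m≤n⇒m<n∨m≡n; +-comm; +-suc; suc-injective; +-cancelˡ-≡; +-cancelˡ-≤; +-cancelˡ-<; +-cancelʳ-≤; +-monoˡ-<; +-monoʳ-<; +-monoʳ-≤; +-mono-≤; m+n∸m≡n; +-∸-assoc; m<n⇒0<n∸m; m+[n∸m]≡n; module ≤-Reasoning)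
open import Data.Nat.Divisibility using (_∣_; divides; ∣m+n∣m⇒∣n; ∣⇒≤)
open import Data.Nat.Tactic.RingSolver using (solve-∀)
open import Data.Fin.Base as Fin using (Fin; toℕ; fromℕ<; opposite)
import Data.Fin.Properties as Fin
open import Data.Fin.Subset using (Subset; _∈_; _⊆_; _∩_; _∪_; ∣_∣; Empty)
open import Data.Fin.Subset.Properties using (_∈?_; ⊆-antisym; x∈p∩q⁺; x∈p∩q⁻; x∈p∪q⁺; x∈p∪q⁻; Empty-unique; ∣⊥∣≡0)
open import Data.List.Base as List using (List; _++_; length; filter)
import Data.List.Membership.DecPropositional as DecMembership
import Data.List.Membership.Propositional as List
open import Data.List.Membership.Propositional.Properties using (∈-map⁺; ∈-++⁺ˡ; ∈-++⁺ʳ; ∈-filter⁺; ∈-filter⁻)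
import Data.List.Properties as List
import Data.List.Relation.Unary.All as All
import Data.List.Relation.Unary.Unique.Propositional.Properties as Unique
open import Data.Empty using (⊥)
open import Data.Product using (_×_; _,_; proj₁; proj₂; ∃)
open import Data.Sum using (_⊎_; inj₁; inj₂)
open import Data.Vec.Base using (tabulate)
import Data.Vec.Properties as Vec
open import Function.Base using (_∘_)
open import Relation.Binary.Definitions using (tri<; tri≈; tri>)
open import Relation.Binary.PropositionalEquality using (_≡_; refl; sym; trans; cong; cong₂; subst; subst₂; module ≡-Reasoning)
open import Relation.Nullary using (does; yes; no; contradiction)
open import Relation.Nullary.Decidable using (_×-dec_; dec-true)
open import Relation.Unary using (Pred; Decidable)

private
  variable
    n t : ℕ

-- Membership in tabulated sets and intervals.

module _ {p} {P : Pred (Fin n) p} (P? : Decidable P) where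

  ∈-tabulate⁺ : ∀ {x} → P x → x ∈ tabulate (does ∘ P?)
  ∈-tabulate⁺ {x} px = Vec.lookup⇒[]= x _
    (trans (Vec.lookup∘tabulate (does ∘ P?) x) (dec-true (P? x) px))

  ∈-tabulate⁻ : ∀ {x} → x ∈ tabulate (does ∘ P?) → P x
  ∈-tabulate⁻ {x} x∈
    with P? x | trans (sym (Vec.lookup∘tabulate (does ∘ P?) x)) (Vec.[]=⇒lookup x∈)
  ... | yes px | _ = px

∈-consecutive⁺ : ∀ r j {x : Fin n} → j ≤ toℕ x → toℕ x < j + r → x ∈ consecutive r n j
∈-consecutive⁺ r j j≤x x<j+r =
  ∈-tabulate⁺ (λ i → (j ≤? toℕ i) ×-dec (toℕ i <? j + r)) (j≤x , x<j+r)

∈-consecutive⁻ : ∀ r j {x : Fin n} → x ∈ consecutive r n j → j ≤ toℕ x × toℕ x < j + r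
∈-consecutive⁻ r j = ∈-tabulate⁻ (λ i → (j ≤? toℕ i) ×-dec (toℕ i <? j + r))

initial : ℕ → Subset n
initial {n} a = consecutive a n 0

∈-initial⁺ : ∀ {a} {x : Fin n} → toℕ x < a → x ∈ initial a
∈-initial⁺ {a = a} = ∈-consecutive⁺ a 0 z≤n

∈-initial⁻ : ∀ {a} {x : Fin n} → x ∈ initial a → toℕ x < a
∈-initial⁻ {a = a} = proj₂ ∘ ∈-consecutive⁻ a 0

-- Reflection of a finite linear order.

toℕ+opposite : (x : Fin n) → suc (toℕ x + toℕ (opposite x)) ≡ n
toℕ+opposite x = trans (cong (suc (toℕ x) +_) (Fin.opposite-prop x)) (m+[n∸m]≡n (Fin.toℕ<n x))

opposite-unique : (x y : Fin n) → suc (toℕ x + toℕ y) ≡ n → opposite x ≡ y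
opposite-unique x y eq =
  Fin.toℕ-injective (+-cancelˡ-≡ (suc (toℕ x)) _ _ (trans (toℕ+opposite x) (sym eq)))

opposite-antitone : {x y : Fin n} → x Fin.≤ y → opposite y Fin.≤ opposite x
opposite-antitone {x = x} {y} x≤y = +-cancelˡ-≤ (suc (toℕ x)) _ _ (begin
  suc (toℕ x + toℕ (opposite y)) ≤⟨ s≤s (+-mono-≤ x≤y ≤-refl) ⟩
  suc (toℕ y + toℕ (opposite y)) ≡⟨ toℕ+opposite y ⟩
  _                              ≡⟨ toℕ+opposite x ⟨
  suc (toℕ x + toℕ (opposite x)) ∎)
  where open ≤-Reasoning

opposite-injective : {x y : Fin n} → opposite x ≡ opposite y → x ≡ y
opposite-injective {x = x} {y} eq =
  trans (sym (Fin.opposite-involutive x)) (trans (cong opposite eq) (Fin.opposite-involutive y))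

reflect : Subset n → Subset n
reflect = image opposite

-- Order embeddings: ranks in an image, left bias, reflection.

module Embedding {s n} {f : Fin s → Fin n} (emb : IsOrderedEmbedding f) where
  open IsOrderedEmbedding emb public

  cancel-≤ : ∀ {x y} → f x Fin.≤ f y → x Fin.≤ y
  cancel-≤ {x} {y} fx≤fy with toℕ x ≤? toℕ y
  ... | yes x≤y = x≤y
  ... | no x≰y  = ≤-reflexive (cong toℕ (injective (Fin.≤-antisym fx≤fy (orderPreserving (<⇒≤ (≰⇒> x≰y))))))

  strictlyMonotone : ∀ {x y} → x Fin.< y → f x Fin.< f y
  strictlyMonotone x<y = ≰⇒> (<⇒≱ x<y ∘ cancel-≤)

  -- An embedding both preserves and reflects `≤`, so the members of the image up to `f i` come
  -- exactly from positions up to `i`. Thus `f i` has rank `suc (toℕ i)` in the image, which serves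
  -- both the left bias and `ranked`.
  initial-∩-image : ∀ {i} → toℕ i < t →
    initial (suc (toℕ (f i))) ∩ image f (initial t) ≡ image f (initial (suc (toℕ i)))
  initial-∩-image {t} {i} i<t = ⊆-antisym to from
    where
    to : initial (suc (toℕ (f i))) ∩ image f (initial t) ⊆ image f (initial (suc (toℕ i)))
    to y∈ with x∈p∩q⁻ (initial (suc (toℕ (f i)))) (image f (initial t)) y∈
    ... | y∈X , y∈S with ∈-image⁻ {f = f} {p = initial t} y∈S
    ...   | x , _ , refl = ∈-image⁺ {f = f} (∈-initial⁺ (s≤s (cancel-≤ (s≤s⁻¹ (∈-initial⁻ y∈X)))))
    from : image f (initial (suc (toℕ i))) ⊆ initial (suc (toℕ (f i))) ∩ image f (initial t)
    from y∈ with ∈-image⁻ {f = f} {p = initial (suc (toℕ i))} y∈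
    ... | x , x∈ , refl = x∈p∩q⁺
      ( ∈-initial⁺ (s≤s (orderPreserving x≤i))
      , ∈-image⁺ {f = f} (∈-initial⁺ (≤-trans (s≤s x≤i) i<t)))
      where x≤i = s≤s⁻¹ (∈-initial⁻ x∈)

  ∣initial-∩-image∣ : ∀ {i} → toℕ i < t →
    ∣ initial (suc (toℕ (f i))) ∩ image f (initial t) ∣ ≡ suc (toℕ i)
  ∣initial-∩-image∣ {t} {i} i<t = begin
    ∣ initial (suc (toℕ (f i))) ∩ image f (initial t) ∣ ≡⟨ cong ∣_∣ (initial-∩-image i<t) ⟩
    ∣ image f (initial (suc (toℕ i))) ∣ ≡⟨ ∣image∣ injective (initial (suc (toℕ i))) ⟩
    ∣ initial {s} (suc (toℕ i)) ∣       ≡⟨ ∣consecutive∣ (suc (toℕ i)) s 0 (Fin.toℕ<n i) ⟩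
    suc (toℕ i)                         ∎
    where open ≡-Reasoning

  -- `X` ends exactly at `f i`, so the rank count gives its intersection with the image, and `Z` is
  -- the mirror image of `X`. The bound says that every `f x` in the image lies before `Z`.
  image-initial-leftBiased : ∀ {i} → toℕ i < t →
    (∀ x → toℕ x < t → suc (toℕ (f i) + toℕ (f x)) < n) →
    IsLeftBiased (suc (toℕ i)) (image f (initial t))
  image-initial-leftBiased {t} {i} i<t bound =
    X , Y , Z , partition , trans ∣X∣ (sym ∣Z∣) , ∣initial-∩-image∣ i<t ,
    trans (cong ∣_∣ (Empty-unique Z∩S-empty)) (∣⊥∣≡0 n)
    where
    a = suc (toℕ (f i))
    b = n ∸ a
    a+b≡n : a + b ≡ n
    a+b≡n = m+[n∸m]≡n (Fin.toℕ<n (f i))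
    b+a≡n : b + a ≡ n
    b+a≡n = trans (+-comm b a) a+b≡n
    -- The bound at `x = i` itself: `X` and its mirror image do not overlap, so `b ∸ a` is the true
    -- length of `Y`.
    a≤b : a ≤ b
    a≤b = +-cancelˡ-≤ a _ _ (≤-trans (≤-reflexive (+-suc a (toℕ (f i)))) (subst (a + toℕ (f i) <_) (sym a+b≡n) (bound i i<t)))
    X = initial a
    Y = consecutive (b ∸ a) n a
    Z = consecutive a n b
    ∣X∣ : ∣ X ∣ ≡ a
    ∣X∣ = ∣consecutive∣ a n 0 (Fin.toℕ<n (f i))
    ∣Z∣ : ∣ Z ∣ ≡ a
    ∣Z∣ = ∣consecutive∣ a n b (≤-reflexive b+a≡n)
    Y⁻ : ∀ {x} → x ∈ Y → a ≤ toℕ x × toℕ x < b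
    Y⁻ {x} x∈Y = let (l , u) = ∈-consecutive⁻ (b ∸ a) a x∈Y in
      l , subst (toℕ x <_) (m+[n∸m]≡n a≤b) u
    Z⁻ : ∀ {x} → x ∈ Z → b ≤ toℕ x
    Z⁻ = proj₁ ∘ ∈-consecutive⁻ a b
    partition : IsIntervalPartition X Y Z
    partition = record
      { X<Y = λ x y x∈ y∈ → <-≤-trans (∈-initial⁻ x∈) (proj₁ (Y⁻ y∈))
      ; Y<Z = λ x y x∈ y∈ → <-≤-trans (proj₂ (Y⁻ x∈)) (Z⁻ y∈)
      ; X<Z = λ x y x∈ y∈ → <-≤-trans (∈-initial⁻ x∈) (≤-trans a≤b (Z⁻ y∈))
      ; covers = covers
      }
      where
      covers : ∀ x → x ∈ X ⊎ x ∈ Y ⊎ x ∈ Z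
      covers x with a ≤? toℕ x | b ≤? toℕ x
      ... | no a≰x  | _       = inj₁ (∈-initial⁺ (≰⇒> a≰x))
      ... | yes a≤x | no b≰x  = inj₂ (inj₁ (∈-consecutive⁺ (b ∸ a) a a≤x
                                  (subst (toℕ x <_) (sym (m+[n∸m]≡n a≤b)) (≰⇒> b≰x))))
      ... | yes _   | yes b≤x = inj₂ (inj₂ (∈-consecutive⁺ a b b≤x
                                  (subst (toℕ x <_) (sym b+a≡n) (Fin.toℕ<n x))))
    Z∩S-empty : Empty (Z ∩ image f (initial t))
    Z∩S-empty (y , y∈) with x∈p∩q⁻ Z (image f (initial t)) y∈
    ... | y∈Z , y∈S with ∈-image⁻ {f = f} {p = initial t} y∈S
    ...   | x , x∈ , refl = <⇒≱
      (+-cancelˡ-< a _ _ (subst (a + toℕ (f x) <_) (sym a+b≡n) (bound x (∈-initial⁻ x∈))))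
      (Z⁻ y∈Z)

  reflected : IsOrderedEmbedding (opposite ∘ f ∘ opposite)
  reflected = record
    { injective       = opposite-injective ∘ injective ∘ opposite-injective
    ; orderPreserving = opposite-antitone ∘ orderPreserving ∘ opposite-antitone
    }

-- Reversal exchanges the last `r` positions with the first `r`. Hence the last edge of a copy is
-- the reflection of the first edge of the conjugated copy, to which the left-bias criterion
-- applies.
reflect-image-initial : ∀ {r s} (f : Fin s → Fin n) j → j + r ≡ s →
  reflect (image (opposite ∘ f ∘ opposite) (initial r)) ≡ image f (consecutive r s j)
reflect-image-initial {r = r} {s} f j j+r≡s = ⊆-antisym to from
  where
  g = opposite ∘ f ∘ opposite
  opposite-g : ∀ x → opposite (g x) ≡ f (opposite x)
  opposite-g x = Fin.opposite-involutive (f (opposite x))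
  to : reflect (image g (initial r)) ⊆ image f (consecutive r s j)
  to y∈ with ∈-image⁻ {f = opposite} {p = image g (initial r)} y∈
  ... | z , z∈ , refl with ∈-image⁻ {f = g} {p = initial r} z∈
  ...   | x , x∈ , refl = subst (_∈ image f (consecutive r s j)) (sym (opposite-g x))
    (∈-image⁺ {f = f} (∈-consecutive⁺ r j
      (+-cancelʳ-≤ r _ _ (begin
        j + r                            ≡⟨ j+r≡s ⟩
        s                                ≡⟨ toℕ+opposite x ⟨
        suc (toℕ x) + toℕ (opposite x)   ≤⟨ +-mono-≤ (∈-initial⁻ x∈) ≤-refl ⟩
        r + toℕ (opposite x)             ≡⟨ +-comm r _ ⟩
        toℕ (opposite x) + r             ∎))
      (subst (toℕ (opposite x) <_) (sym j+r≡s) (Fin.toℕ<n (opposite x)))))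
    where open ≤-Reasoning
  from : image f (consecutive r s j) ⊆ reflect (image g (initial r))
  from y∈ with ∈-image⁻ {f = f} {p = consecutive r s j} y∈
  ... | x , x∈ , refl = subst (_∈ reflect (image g (initial r)))
    (trans (opposite-g (opposite x)) (cong f (Fin.opposite-involutive x)))
    (∈-image⁺ {f = opposite} (∈-image⁺ {f = g} (∈-initial⁺ (+-cancelˡ-≤ j _ _ (begin
      j + suc (toℕ (opposite x))         ≤⟨ +-mono-≤ (proj₁ (∈-consecutive⁻ r j x∈)) ≤-refl ⟩
      toℕ x + suc (toℕ (opposite x))     ≡⟨ +-suc (toℕ x) _ ⟩
      suc (toℕ x + toℕ (opposite x))     ≡⟨ toℕ+opposite x ⟩
      s                                  ≡⟨ j+r≡s ⟨
      j + r                              ∎)))))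
    where open ≤-Reasoning

-- Recovering the deleted vertex in a tie.

-- The singleton of the m-th smallest element of S, or ∅ if there is none.
ranked : ℕ → Subset n → Subset n
ranked m S = tabulate (does ∘ λ x → (x ∈? S) ×-dec (∣ initial (suc (toℕ x)) ∩ S ∣ ≟ m))

-- This is a function of `m` and `S` alone, independent of any embedding, so the tied edges it
-- yields are no more numerous than the sets `S` it is applied to.
completeTie : ℕ → Subset n → Subset n
completeTie m S = S ∪ reflect (ranked m S)

module _ {s} {f : Fin s → Fin n} (emb : IsOrderedEmbedding f) where
  open Embedding emb

  module _ {t} {i : Fin s} (i<t : toℕ i < t) where
    private
      S = image f (initial t)
      m = suc (toℕ i)
      ranked? : Decidable λ x → x ∈ S × ∣ initial (suc (toℕ x)) ∩ S ∣ ≡ m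
      ranked? x = (x ∈? S) ×-dec (∣ initial (suc (toℕ x)) ∩ S ∣ ≟ m)

    ∈-ranked⁺ : f i ∈ ranked m S
    ∈-ranked⁺ = ∈-tabulate⁺ ranked? (∈-image⁺ {f = f} (∈-initial⁺ i<t) , ∣initial-∩-image∣ i<t)

    ∈-ranked⁻ : ∀ {y} → y ∈ ranked m S → y ≡ f i
    ∈-ranked⁻ y∈ with ∈-tabulate⁻ ranked? y∈
    ... | y∈S , rank with ∈-image⁻ {f = f} {p = initial t} y∈S
    ...   | x , x∈ , refl = cong f (Fin.toℕ-injective (suc-injective
      (trans (sym (∣initial-∩-image∣ {t = t} (∈-initial⁻ x∈))) rank)))

    -- By uniqueness of ranks, `ranked m S` contains only `f i`. Its reflection is `f l`, and `l` is
    -- the one position in `initial (suc t)` outside `initial t`.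
    completeTie-image-initial : ∀ {l} → toℕ l ≡ t → opposite (f i) ≡ f l →
      completeTie m S ≡ image f (initial (suc t))
    completeTie-image-initial {l} refl opp = ⊆-antisym to from
      where
      to : completeTie m S ⊆ image f (initial (suc t))
      to y∈ with x∈p∪q⁻ S (reflect (ranked m S)) y∈
      ... | inj₁ y∈S with ∈-image⁻ {f = f} {p = initial t} y∈S
      ...   | x , x∈ , refl = ∈-image⁺ {f = f} (∈-initial⁺ (s≤s (<⇒≤ (∈-initial⁻ x∈))))
      to y∈ | inj₂ y∈R with ∈-image⁻ {f = opposite} {p = ranked m S} y∈R
      ...   | x , x∈ , refl = subst (_∈ image f (initial (suc t)))
        (sym (trans (cong opposite (∈-ranked⁻ x∈)) opp)) (∈-image⁺ {f = f} {x = l} (∈-initial⁺ ≤-refl))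
      from : image f (initial (suc t)) ⊆ completeTie m S
      from y∈ with ∈-image⁻ {f = f} {p = initial (suc t)} y∈
      ... | x , x∈ , refl with m≤n⇒m<n∨m≡n (s≤s⁻¹ (∈-initial⁻ x∈))
      ...   | inj₁ x<t = x∈p∪q⁺ (inj₁ (∈-image⁺ {f = f} (∈-initial⁺ x<t)))
      ...   | inj₂ x≡t = x∈p∪q⁺ (inj₂ (subst (_∈ reflect (ranked m S))
        (trans opp (cong f (sym (Fin.toℕ-injective x≡t)))) (∈-image⁺ {f = opposite} ∈-ranked⁺)))

-- The two edges of the loose path.

loosePath-first : ∀ {r s} → r ≤ s → OrderedHypergraph.Edge (loosePath r s) (initial r)
loosePath-first {r} {s} r≤s =
  fromℕ< 0<k , inj₁ toℕ≡ , cong (consecutive r s) (sym toℕ≡)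
  where
  0<k = m<n⇒0<n∸m (s≤s r≤s)
  toℕ≡ = Fin.toℕ-fromℕ< 0<k

loosePath-last : ∀ {r s} → r ≤ s → OrderedHypergraph.Edge (loosePath r s) (consecutive r s (s ∸ r))
loosePath-last {r} {s} r≤s =
  fromℕ< d<k , inj₂ (trans (cong suc toℕ≡) (sym k≡)) , cong (consecutive r s) (sym toℕ≡)
  where
  k≡ = +-∸-assoc 1 r≤s
  d<k = ≤-reflexive (sym k≡)
  toℕ≡ = Fin.toℕ-fromℕ< d<k

-- Arithmetic of reflection and parity.

-- The two quantities `suc (a + b)` and `suc (a′ + b′)` add up to `n + n`, so if one exceeds `n` the
-- other falls below it.
reflect-< : ∀ {a a′ b b′} → suc (a + a′) ≡ n → suc (b + b′) ≡ n → n < suc (a + b) → suc (a′ + b′) < n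
reflect-< {n} {a} {a′} {b} {b′} p q n< = +-cancelˡ-< n _ _ (begin-strict
  n + suc (a′ + b′)               <⟨ +-monoˡ-< (suc (a′ + b′)) n< ⟩
  suc (a + b) + suc (a′ + b′)     ≡⟨ rearrange a a′ b b′ ⟩
  suc (a + a′) + suc (b + b′)     ≡⟨ cong₂ _+_ p q ⟩
  n + n                           ∎)
  where
  open ≤-Reasoning
  rearrange : ∀ a a′ b b′ → suc (a + b) + suc (a′ + b′) ≡ suc (a + a′) + suc (b + b′)
  rearrange = solve-∀

odd≢even : ∀ k q → suc (k + k) ≡ q * 2 → ⊥
odd≢even k q eq = 2∤1 (∣m+n∣m⇒∣n {m = k + k} (divides q (trans (+-comm (k + k) 1) eq)) (divides k (double k)))
  where
  double : ∀ k → k + k ≡ k * 2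
  double = solve-∀
  2∤1 : 2 ∣ 1 → ⊥
  2∤1 2∣1 = <⇒≱ (s≤s (s≤s z≤n)) (∣⇒≤ 2∣1)

-- The transversal for the loose path, with `t = r - 1` and `d = s - r`.

module _ (n t d : ℕ) (2∣n : 2 ∣ n) (d≤t : d ≤ t) where
  private
    r = suc t
    s = r + d
    m = suc d
    r≤s : r ≤ s
    r≤s = m≤m+n r d
    s∸r≡d : s ∸ r ≡ d
    s∸r≡d = m+n∸m≡n r d
    d+r≡s : d + r ≡ s
    d+r≡s = +-comm d r
    i l : Fin s
    i = fromℕ< {d} (s≤s (m≤n+m d t))
    l = fromℕ< {t} r≤s
    i≡d : toℕ i ≡ d
    i≡d = Fin.toℕ-fromℕ< _
    l≡t : toℕ l ≡ t
    l≡t = Fin.toℕ-fromℕ< _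
    -- The positions `d` and `t` sum to `s - 1`, so reversing the path exchanges them. This is why a
    -- single comparison of `f i + f l` with `n - 1` settles both edges.
    opposite-l : opposite l ≡ i
    opposite-l = opposite-unique l i (cong suc (cong₂ _+_ l≡t i≡d))

    biased : ∀ t → List (Subset n)
    biased t = filter (isLeftBiased? m) (subsetsOfSize n t)

    candidates : List (Subset n)
    candidates = biased r ++ List.map reflect (biased r) ++ List.map (completeTie m) (biased t)

    ∈candidates? : Decidable (List._∈ candidates)
    ∈candidates? e = DecMembership._∈?_ _≟ˢ_ e candidates

    length-candidates : length candidates ≡ 2 * h n r m + h n t m
    length-candidates = begin
      length candidates
        ≡⟨ List.length-++ (biased r) ⟩
      h n r m + length (List.map reflect (biased r) ++ List.map (completeTie m) (biased t))
        ≡⟨ cong (h n r m +_) (List.length-++ (List.map reflect (biased r))) ⟩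
      h n r m + (length (List.map reflect (biased r)) + length (List.map (completeTie m) (biased t)))
        ≡⟨ cong (h n r m +_) (cong₂ _+_ (List.length-map reflect (biased r)) (List.length-map (completeTie m) (biased t))) ⟩
      h n r m + (h n r m + h n t m)
        ≡⟨ rearrange (h n r m) (h n t m) ⟩
      2 * h n r m + h n t m ∎
      where
      open ≡-Reasoning
      rearrange : ∀ x y → x + (x + y) ≡ 2 * x + y
      rearrange = solve-∀

    -- The size `u` is left free: `u = r` serves both strict cases, and `u = t` the tie.
    image-initial-biased : ∀ {f : Fin s → Fin n} (emb : IsOrderedEmbedding f) {u} → u ≤ s → d < u →
      (∀ x → toℕ x < u → suc (toℕ (f i) + toℕ (f x)) < n) → image f (initial u) List.∈ biased u
    image-initial-biased {f} emb {u} u≤s d<u bound = ∈-filter⁺ (isLeftBiased? m)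
      (∈-subsetsOfSize (trans (∣image∣ injective (initial u)) (∣consecutive∣ u s 0 u≤s)))
      (subst (λ k → IsLeftBiased (suc k) (image f (initial u))) i≡d
        (image-initial-leftBiased (subst (_< u) (sym i≡d) d<u) bound))
      where open Embedding emb

    meets-candidates : ∀ (f : Fin s → Fin n) → IsOrderedEmbedding f →
      ∃ λ e → OrderedHypergraph.Edge (loosePath r s) e × image f e List.∈ candidates
    meets-candidates f emb with <-cmp (suc (toℕ (f i) + toℕ (f l))) n
    ... | tri< <n _ _ = initial r , loosePath-first r≤s ,
      ∈-++⁺ˡ (image-initial-biased emb r≤s (s≤s d≤t) λ x x<r →
        -- `f l` is the largest vertex of the first edge, so the bound there gives all the others.
        ≤-<-trans (s≤s (+-monoʳ-≤ (toℕ (f i)) (orderPreserving (≤-trans (s≤s⁻¹ x<r) (≤-reflexive (sym l≡t)))))) <n)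
      where open Embedding emb
    ... | tri> _ _ n< = consecutive r s d ,
      subst (OrderedHypergraph.Edge (loosePath r s) ∘ consecutive r s) s∸r≡d (loosePath-last r≤s) ,
      subst (List._∈ candidates) (reflect-image-initial f d d+r≡s)
        (∈-++⁺ʳ (biased r) (∈-++⁺ˡ (∈-map⁺ reflect (image-initial-biased reflected r≤s (s≤s d≤t) bound))))
      where
      open Embedding emb
      g = opposite ∘ f ∘ opposite
      gi≡ : g i ≡ opposite (f l)
      gi≡ = cong (opposite ∘ f) (trans (cong opposite (sym opposite-l)) (Fin.opposite-involutive l))
      -- For `x < r`, `opposite x` is at or after `i`, so `f l + f (opposite x)` is at least
      -- `f l + f i`. The excess over `n` persists, and `reflect-<` turns it into the bound for `g`.
      bound : ∀ x → toℕ x < r → suc (toℕ (g i) + toℕ (g x)) < n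
      bound x x<r = reflect-< {a = toℕ (f l)} {toℕ (g i)} {toℕ (f (opposite x))} {toℕ (g x)}
        (trans (cong (λ z → suc (toℕ (f l) + toℕ z)) gi≡) (toℕ+opposite (f l)))
        (toℕ+opposite (f (opposite x)))
        (<-≤-trans n< (s≤s (≤-trans (≤-reflexive (+-comm (toℕ (f i)) (toℕ (f l))))
          (+-monoʳ-≤ (toℕ (f l)) (orderPreserving i≤)))))
        where
        i≤ : i Fin.≤ opposite x
        i≤ = subst (Fin._≤ opposite x) opposite-l
          (opposite-antitone {x = x} {l} (≤-trans (s≤s⁻¹ x<r) (≤-reflexive (sym l≡t))))
    ... | tri≈ _ ≡n _ = initial r , loosePath-first r≤s ,
      ∈-++⁺ʳ (biased r) (∈-++⁺ʳ (List.map reflect (biased r))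
        (subst (List._∈ List.map (completeTie m) (biased t)) completed
          (∈-map⁺ (completeTie m) (image-initial-biased emb (<⇒≤ r≤s) d<t bound))))
      where
      open Embedding emb
      -- If `d = t`, then `i = l` and the tie would make `n` equal to the odd number
      -- `2 * toℕ (f i) + 1`. Strictness keeps `f i` in the set after `f l` is deleted.
      d<t : d < t
      d<t with m≤n⇒m<n∨m≡n d≤t
      ... | inj₁ d<t = d<t
      ... | inj₂ d≡t = contradiction
        (trans (cong (λ z → suc (toℕ (f i) + toℕ (f z))) (Fin.toℕ-injective (trans i≡d (trans d≡t (sym l≡t)))))
          (trans ≡n (_∣_.equality 2∣n)))
        (odd≢even (toℕ (f i)) (_∣_.quotient 2∣n))
      completed : completeTie m (image f (initial t)) ≡ image f (initial r)
      completed = subst (λ k → completeTie (suc k) (image f (initial t)) ≡ image f (initial r)) i≡d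
        (completeTie-image-initial emb (subst (_< t) (sym i≡d) d<t) l≡t (opposite-unique (f i) (f l) ≡n))
      -- All remaining vertices lie strictly before `f l`, so the tie becomes a strict inequality.
      bound : ∀ x → toℕ x < t → suc (toℕ (f i) + toℕ (f x)) < n
      bound x x<t = subst (suc (toℕ (f i) + toℕ (f x)) <_) ≡n
        (s≤s (+-monoʳ-< (toℕ (f i)) (strictlyMonotone (subst (toℕ x <_) (sym l≡t) x<t))))

    -- Selecting from the duplicate-free list of `r`-subsets secures distinctness and uniformity
    -- without examining `candidates` for either. The selection is no longer than `candidates`,
    -- which is all that the upper bound requires.
    transversal : IsTransversal n (loosePath r s) (filter ∈candidates? (subsetsOfSize n r))
    transversal = record
      { unique  = Unique.filter⁺ ∈candidates? (subsetsOfSize-unique n r)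
      ; uniform = All.tabulate λ e∈ → All.lookup (subsetsOfSize-size n r)
          (proj₁ (∈-filter⁻ ∈candidates? {xs = subsetsOfSize n r} e∈))
      ; meets   = λ f emb → let (e , e∈E , fe∈) = meets-candidates f emb in
          e , e∈E , ∈-filter⁺ ∈candidates?
            (∈-subsetsOfSize (trans (∣image∣ (IsOrderedEmbedding.injective emb) e)
                                    (OrderedHypergraph.uniform (loosePath r s) e∈E))) fe∈
      }

  τ-loosePath-≤ : τ n (loosePath r s) ≤ 2 * h n r m + h n t m
  τ-loosePath-≤ = begin
    τ n (loosePath r s)
      ≤⟨ lowerBound transversal ⟩
    length (filter ∈candidates? (subsetsOfSize n r))
      ≤⟨ unique-length-≤ (IsTransversal.unique transversal)
           (proj₂ ∘ ∈-filter⁻ ∈candidates? {xs = subsetsOfSize n r}) ⟩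
    length candidates
      ≡⟨ length-candidates ⟩
    2 * h n r m + h n t m ∎
    where
    open ≤-Reasoning
    open IsMinimumTransversalSize (τ-isMinimum n (loosePath r s) (_ , loosePath-first r≤s))

-- Comparison with the tight path, and the combined bound.

τ-tightPath-≤-loosePath : ∀ {r s} n → r ≤ s → τ n (tightPath r s) ≤ τ n (loosePath r s)
τ-tightPath-≤-loosePath {r} {s} n r≤s
  with T , tr , eq ← IsMinimumTransversalSize.attained
         (τ-isMinimum n (loosePath r s) (_ , loosePath-first r≤s)) =
  subst (τ n (tightPath r s) ≤_) eq
    (IsMinimumTransversalSize.lowerBound
      (τ-isMinimum n (tightPath r s) (_ , tight (loosePath-first r≤s)))
      record
        { unique  = unique
        ; uniform = uniform
        -- Both paths have the same vertices, hence the same embeddings, and an edge of the loose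
        -- path is one of the tight path; a minimum transversal for the former thus meets every copy
        -- of the latter.
        ; meets   = λ f emb → let (e , e∈E , fe∈T) = meets f emb in e , tight e∈E , fe∈T
        })
  where
  open IsTransversal tr
  tight : ∀ {e} → OrderedHypergraph.Edge (loosePath r s) e → OrderedHypergraph.Edge (tightPath r s) e
  tight (j , _ , eq) = j , eq

theorem2p1 : (n r s m : ℕ) → 2 ∣ n → 1 ≤ r → r ≤ s → s ≤ 2 * r ∸ 1 → m ≡ s ∸ r + 1 →
    (τ n (tightPath r s) ≤ τ n (loosePath r s)) ×
    (τ n (loosePath r s) ≤ 2 * h n r m + h n (r ∸ 1) m)
theorem2p1 n (suc t) s _ 2∣n _ r≤s s≤2r-1 refl = τ-tightPath-≤-loosePath n r≤s ,
  subst₂ (λ s m → τ n (loosePath (suc t) s) ≤ 2 * h n (suc t) m + h n t m)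
    (m+[n∸m]≡n r≤s) (+-comm 1 d) (τ-loosePath-≤ n t d 2∣n d≤t)
  where
  d = s ∸ suc t
  d≤t : d ≤ t
  d≤t = +-cancelˡ-≤ (suc t) _ _ (begin
    suc t + d       ≡⟨ m+[n∸m]≡n r≤s ⟩
    s               ≤⟨ s≤2r-1 ⟩
    -- This is the normal form of `2 * suc t ∸ 1`; the hypothesis on `s` thus becomes
    -- `r + d ≤ r + t`.
    t + suc (t + 0) ≡⟨ rearrange t ⟩
    suc t + t       ∎)
    where
    open ≤-Reasoning
    rearrange : ∀ t → t + suc (t + 0) ≡ suc t + t
    rearrange = solve-∀
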